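{- Let $(G_m)_{m\in\mathbb{Z}}$ be a generalized Fibonacci sequence, let $a,b$ be integers, let $n\ge 0$ be an integer, and let $x$ be a complex number such that $\Delta := 1-L_b x+(-1)^b x^2\neq 0$. Then $$\begin{aligned} \sum_{k=0}^n x^k k^2 G_{a+bk} = {}& -\frac{1}{\Delta}(n+1)^2 x^{n+1} P(1,n+1) \\ & - \frac{1}{\Delta^2} \left[ (2n+3) x^{n+2} P(2,n+2) - x P(2,1) \right] \\ & - \frac{2}{\Delta^3} \left[ x^{n+3} P(3,n+3) - x^2 P(3,2) \right]. \end{aligned}$$
   Context: A generalized Fibonacci sequence is a sequence $(G_m)_{m\in\mathbb{Z}}$ of complex numbers with $G_{m+2}=G_{m+1}+G_m$ for all integers $m$ (with arbitrary seed $G_0,G_1$). $L_m$ is the Lucas number: $L_0=2$, $L_1=1$, $L_{m+2}=L_{m+1}+L_m$ for all integers $m$ (including negative indices). For given $a,b,x$ and $G$, and for integers $v,w\ge 0$, $P(v,w) = \sum_{k=0}^v \binom{v}{k} (-1)^{(b+1)k} x^k G_{a+bw-bk}$. Convention: $x^0=1$, also for $x=0$. -}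

module Defs where

open import Algebra.Apartness.Bundles using (HeytingCommutativeRing; HeytingField)
open import Algebra.Bundles using (CommutativeRing)
open import Data.Empty using (⊥-elim)
open import Data.Fin.Base using (toℕ)
open import Data.Integer.Base as ℤ using (ℤ; +_; -[1+_])
open import Data.Nat.Base as ℕ using (ℕ; zero; suc)
import Data.Nat.Properties as ℕ
open import Data.Nat.Combinatorics using (_C_)
open import Data.Product.Base using (∃-syntax; _×_; _,_; proj₁; proj₂)
open import Data.Sum.Base as Sum using (_⊎_; inj₁; inj₂)
open import Level using (0ℓ)
open import Relation.Binary.PropositionalEquality
  using (_≡_; _≢_; refl; sym; trans; cong; cong₂; subst; subst₂)
open import Relation.Nullary using (¬_; yes; no)

-- The library has no real numbers, so ℝ is built here from Cauchy sequences of
-- rationals, with equality meaning that the difference tends to 0.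

module Real where

  open import Data.Rational.Base
  open import Data.Rational.Properties
  open import Data.Rational.Solver using (module +-*-Solver)
  open +-*-Solver using (solve; _:=_; _:+_; _:*_; :-_; _:-_; con)

  Eventually : (ℕ → Set) → Set
  Eventually P = ∃[ N ] (∀ {n} → N ℕ.≤ n → P n)

  Eventually₂ : (ℕ → ℕ → Set) → Set
  Eventually₂ P = ∃[ N ] (∀ {m n} → N ℕ.≤ m → N ℕ.≤ n → P m n)

  IsCauchy : (ℕ → ℚ) → Set
  IsCauchy s = ∀ {ε} → 0ℚ < ε → Eventually₂ λ m n → ∣ s m - s n ∣ < ε

  record ℝ : Set where
    no-eta-equality
    field
      seq    : ℕ → ℚ
      cauchy : IsCauchy seq

  open ℝ public

  infix 4 _≈_ _#_

  record _≈_ (x y : ℝ) : Set where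
    constructor mk≈
    field
      limit : ∀ {ε} → 0ℚ < ε → Eventually λ n → ∣ seq x n - seq y n ∣ < ε

  open _≈_ public

  -- Apartness: the constructively meaningful (classically equivalent) form of x ≠ y.
  record _#_ (x y : ℝ) : Set where
    constructor mk#
    field
      gap       : ℚ
      gap>0     : 0ℚ < gap
      separated : Eventually λ n → gap ≤ ∣ seq x n - seq y n ∣

  private
    both : ∀ {P Q R : ℕ → Set} → (∀ {n} → P n → Q n → R n) →
           Eventually P → Eventually Q → Eventually R
    both f (M , p) (N , q) = M ℕ.⊔ N , λ h →
      f (p (ℕ.m⊔n≤o⇒m≤o M N h)) (q (ℕ.m⊔n≤o⇒n≤o M N h))

    both₂ : ∀ {P Q R : ℕ → ℕ → Set} → (∀ {m n} → P m n → Q m n → R m n) →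
            Eventually₂ P → Eventually₂ Q → Eventually₂ R
    both₂ f (M , p) (N , q) = M ℕ.⊔ N , λ h k →
      f (p (ℕ.m⊔n≤o⇒m≤o M N h) (ℕ.m⊔n≤o⇒m≤o M N k))
        (q (ℕ.m⊔n≤o⇒n≤o M N h) (ℕ.m⊔n≤o⇒n≤o M N k))

    at₁ : ∀ {P : ℕ → Set} → Eventually P → Eventually₂ λ m _ → P m
    at₁ (N , p) = N , λ h _ → p h

    at₂ : ∀ {P : ℕ → Set} → Eventually P → Eventually₂ λ _ n → P n
    at₂ (N , p) = N , λ _ → p

    ever : ∀ {P : ℕ → Set} → Eventually P → ∃[ n ] P n
    ever (N , p) = N , p ℕ.≤-refl

    0<1 : 0ℚ < 1ℚ
    0<1 = positive⁻¹ 1ℚ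

    +-pos : ∀ {p q} → 0ℚ < p → 0ℚ < q → 0ℚ < p + q
    +-pos = +-mono-<

    *-pos : ∀ {p q} → 0ℚ < p → 0ℚ < q → 0ℚ < p * q
    *-pos {p} {q} p>0 q>0 = positive⁻¹ (p * q) {{pos*pos⇒pos p {{positive p>0}} q {{positive q>0}}}}

    inv : ℚ → ℚ
    inv q with q ≟ 0ℚ
    ... | yes _  = 0ℚ
    ... | no q≢0 = 1/_ q {{≢-nonZero q≢0}}

    inv-inverse : ∀ {q} → q ≢ 0ℚ → q * inv q ≡ 1ℚ
    inv-inverse {q} q≢0 with q ≟ 0ℚ
    ... | yes q≡0 = ⊥-elim (q≢0 q≡0)
    ... | no  q≢0 = *-inverseʳ q {{≢-nonZero q≢0}}

    >0⇒≢0 : ∀ {q} → 0ℚ < q → q ≢ 0ℚ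
    >0⇒≢0 q>0 refl = <-irrefl refl q>0

    inv-pos : ∀ {q} → 0ℚ < q → 0ℚ < inv q
    inv-pos {q} q>0 with q ≟ 0ℚ
    ... | yes refl = ⊥-elim (<-irrefl refl q>0)
    ... | no  q≢0  = positive⁻¹ _ {{1/pos⇒pos q {{positive q>0}}}}

    apart⇒≢0 : ∀ {ε q} → 0ℚ < ε → ε ≤ ∣ q ∣ → q ≢ 0ℚ
    apart⇒≢0 ε>0 ε≤ refl = <-irrefl refl (<-≤-trans ε>0 ε≤)

    rescale : ∀ (P : ℚ → Set) {K} → 0ℚ < K →
              (∀ {ε} → 0ℚ < ε → P (K * ε)) → ∀ {ε} → 0ℚ < ε → P ε
    rescale P {K} K>0 f {ε} ε>0 = subst P eq (f (*-pos (inv-pos K>0) ε>0))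
      where
      eq : K * (inv K * ε) ≡ ε
      eq = trans (sym (*-assoc K (inv K) ε))
           (trans (cong (_* ε) (inv-inverse (>0⇒≢0 K>0))) (*-identityˡ ε))

    ∣+∣< : ∀ {p q a b} → ∣ p ∣ < a → ∣ q ∣ < b → ∣ p + q ∣ < a + b
    ∣+∣< {p} {q} p<a q<b = ≤-<-trans (∣p+q∣≤∣p∣+∣q∣ p q) (+-mono-< p<a q<b)

    ∣*∣< : ∀ {p q B a} → 0ℚ < B → ∣ p ∣ ≤ B → ∣ q ∣ < a → ∣ p * q ∣ < B * a
    ∣*∣< {p} {q} {B} {a} B>0 p≤B q<a = subst (_< B * a) (sym (∣p*q∣≡∣p∣*∣q∣ p q))
      (≤-<-trans (*-monoʳ-≤-nonNeg ∣ q ∣ {{∣-∣-nonNeg q}} p≤B)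
                 (*-monoʳ-<-pos B {{positive B>0}} q<a))

    ∣-∣-sym : ∀ p q → ∣ p - q ∣ ≡ ∣ q - p ∣
    ∣-∣-sym p q = trans (cong ∣_∣ (solve 2 (λ p q → p :- q := :- (q :- p)) refl p q))
                        (∣-p∣≡∣p∣ (q - p))

    product-bound : ∀ {p q r s B C ε} → 0ℚ < B → 0ℚ < C → ∣ p ∣ ≤ B → ∣ s ∣ ≤ C →
                    ∣ p - r ∣ < ε → ∣ q - s ∣ < ε → ∣ p * q - r * s ∣ < (B + C) * ε
    product-bound {p} {q} {r} {s} {B} {C} {ε} B>0 C>0 p≤B s≤C p-r<ε q-s<ε =
      subst₂ (λ u v → ∣ u ∣ < v)
        (solve 4 (λ p q r s → p :* (q :- s) :+ s :* (p :- r) := p :* q :- r :* s) refl p q r s)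
        (sym (*-distribʳ-+ ε B C))
        (∣+∣< (∣*∣< B>0 p≤B q-s<ε) (∣*∣< C>0 s≤C p-r<ε))

    bounded : ∀ x → ∃[ B ] (0ℚ < B × Eventually λ n → ∣ seq x n ∣ ≤ B)
    bounded x with cauchy x 0<1
    ... | N , close = ∣ seq x N ∣ + 1ℚ
                    , +-mono-≤-< (0≤∣p∣ (seq x N)) 0<1
                    , N , λ {n} N≤n →
      subst (λ u → ∣ u ∣ ≤ ∣ seq x N ∣ + 1ℚ)
        (solve 2 (λ p q → p :+ (q :- p) := q) refl (seq x N) (seq x n))
        (≤-trans (∣p+q∣≤∣p∣+∣q∣ (seq x N) (seq x n - seq x N))
                 (+-monoʳ-≤ ∣ seq x N ∣ (<⇒≤ (close N≤n ℕ.≤-refl))))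

  fromℚ : ℚ → ℝ
  fromℚ q .seq _ = q
  fromℚ q .cauchy {ε} ε>0 = 0 , λ _ _ → subst (λ u → ∣ u ∣ < ε) (sym (+-inverseʳ q)) ε>0

  infixl 6 _+ᴿ_ _-ᴿ_
  infixl 7 _*ᴿ_
  infix  8 -ᴿ_

  _+ᴿ_ : ℝ → ℝ → ℝ
  (x +ᴿ y) .seq n = seq x n + seq y n
  (x +ᴿ y) .cauchy = rescale
    (λ ε → Eventually₂ λ m n → ∣ (seq x m + seq y m) - (seq x n + seq y n) ∣ < ε)
    (+-pos 0<1 0<1) λ {ε} ε>0 →
    both₂ (λ {m} {n} p q → subst₂ (λ u v → ∣ u ∣ < v)
        (solve 4 (λ a b c d → (a :- b) :+ (c :- d) := (a :+ c) :- (b :+ d)) refl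
          (seq x m) (seq x n) (seq y m) (seq y n))
        (solve 1 (λ e → e :+ e := (con 1ℚ :+ con 1ℚ) :* e) refl ε)
        (∣+∣< p q))
      (cauchy x ε>0) (cauchy y ε>0)

  -ᴿ_ : ℝ → ℝ
  (-ᴿ x) .seq n = - seq x n
  (-ᴿ x) .cauchy {ε} ε>0 =
    let (N , p) = cauchy x ε>0 in N , λ {m} {n} h k →
    subst (_< ε) (trans (∣-∣-sym (seq x m) (seq x n)) (cong ∣_∣
      (solve 2 (λ a b → b :- a := (:- a) :- (:- b)) refl (seq x m) (seq x n)))) (p h k)

  _-ᴿ_ : ℝ → ℝ → ℝ
  x -ᴿ y = x +ᴿ (-ᴿ y)

  _*ᴿ_ : ℝ → ℝ → ℝ
  (x *ᴿ y) .seq n = seq x n * seq y n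
  (x *ᴿ y) .cauchy =
    let (B , B>0 , x≤B) = bounded x
        (C , C>0 , y≤C) = bounded y
    in rescale (λ ε → Eventually₂ λ m n → ∣ seq x m * seq y m - seq x n * seq y n ∣ < ε)
         (+-pos B>0 C>0) λ ε>0 →
         both₂ (λ {m} {n} (p , r) (q , s) →
             product-bound {seq x m} {seq y m} {seq x n} {seq y n} B>0 C>0 p q r s)
           (both₂ _,_ (at₁ x≤B) (cauchy x ε>0))
           (both₂ _,_ (at₂ y≤C) (cauchy y ε>0))

  pointwise : ∀ {x y} → (∀ n → seq x n ≡ seq y n) → x ≈ y
  pointwise {x} {y} eq = mk≈ λ {ε} ε>0 → 0 , λ {n} _ → subst (λ u → ∣ u ∣ < ε)
    (sym (trans (cong (_- seq y n) (eq n)) (+-inverseʳ (seq y n)))) ε>0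

  ≈-sym : ∀ {x y} → x ≈ y → y ≈ x
  ≈-sym {x} {y} x≈y = mk≈ λ {ε} ε>0 → let (N , p) = limit x≈y ε>0 in
    N , λ {n} h → subst (_< ε) (∣-∣-sym (seq x n) (seq y n)) (p h)

  ≈-trans : ∀ {x y z} → x ≈ y → y ≈ z → x ≈ z
  ≈-trans {x} {y} {z} x≈y y≈z = mk≈ (rescale _ (+-pos 0<1 0<1) λ {ε} ε>0 →
    both (λ {n} p q → subst₂ (λ u v → ∣ u ∣ < v)
        (solve 3 (λ a b c → (a :- b) :+ (b :- c) := a :- c) refl (seq x n) (seq y n) (seq z n))
        (solve 1 (λ e → e :+ e := (con 1ℚ :+ con 1ℚ) :* e) refl ε)
        (∣+∣< p q))
      (limit x≈y ε>0) (limit y≈z ε>0))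

  +-congᴿ : ∀ {x x′ y y′} → x ≈ x′ → y ≈ y′ → x +ᴿ y ≈ x′ +ᴿ y′
  +-congᴿ {x} {x′} {y} {y′} x≈ y≈ = mk≈ (rescale _ (+-pos 0<1 0<1) λ {ε} ε>0 →
    both (λ {n} p q → subst₂ (λ u v → ∣ u ∣ < v)
        (solve 4 (λ a b c d → (a :- b) :+ (c :- d) := (a :+ c) :- (b :+ d)) refl
          (seq x n) (seq x′ n) (seq y n) (seq y′ n))
        (solve 1 (λ e → e :+ e := (con 1ℚ :+ con 1ℚ) :* e) refl ε)
        (∣+∣< p q))
      (limit x≈ ε>0) (limit y≈ ε>0))

  -‿congᴿ : ∀ {x y} → x ≈ y → -ᴿ x ≈ -ᴿ y
  -‿congᴿ {x} {y} x≈y = mk≈ λ {ε} ε>0 → let (N , p) = limit x≈y ε>0 in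
    N , λ {n} h → subst (_< ε) (trans (∣-∣-sym (seq x n) (seq y n)) (cong ∣_∣
      (solve 2 (λ a b → b :- a := (:- a) :- (:- b)) refl (seq x n) (seq y n)))) (p h)

  *-congᴿ : ∀ {x x′ y y′} → x ≈ x′ → y ≈ y′ → x *ᴿ y ≈ x′ *ᴿ y′
  *-congᴿ {x} {x′} {y} {y′} x≈ y≈ = mk≈
    let (B , B>0 , x≤B) = bounded x
        (C , C>0 , y≤C) = bounded y′
    in rescale (λ ε → Eventually λ n → ∣ seq x n * seq y n - seq x′ n * seq y′ n ∣ < ε)
         (+-pos B>0 C>0) λ ε>0 →
         both (λ {n} (p , r) (q , s) →
             product-bound {seq x n} {seq y n} {seq x′ n} {seq y′ n} B>0 C>0 p q r s)
           (both _,_ x≤B (limit x≈ ε>0))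
           (both _,_ y≤C (limit y≈ ε>0))

  #-irrefl : ∀ {x y} → x ≈ y → ¬ (x # y)
  #-irrefl x≈y (mk# ε ε>0 far) with ever (both _,_ (limit x≈y ε>0) far)
  ... | _ , near , ε≤ = <-irrefl refl (<-≤-trans near ε≤)

  #-sym : ∀ {x y} → x # y → y # x
  #-sym {x} {y} (mk# ε ε>0 (N , far)) = mk# ε ε>0
    (N , λ {n} h → subst (ε ≤_) (∣-∣-sym (seq x n) (seq y n)) (far h))

  near-or-apart : ∀ x y {ε} → 0ℚ < ε → (Eventually λ n → ∣ seq x n - seq y n ∣ < ε) ⊎ x # y
  near-or-apart x y = rescale
    (λ ε → (Eventually λ n → ∣ seq x n - seq y n ∣ < ε) ⊎ x # y)
    (+-pos (+-pos 0<1 0<1) 0<1) λ u>0 → go u>0 (cauchy (x -ᴿ y) u>0)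
    where
    d = seq (x -ᴿ y)
    go : ∀ {u} → 0ℚ < u → Eventually₂ (λ m n → ∣ d m - d n ∣ < u) →
         (Eventually λ n → ∣ d n ∣ < (1ℚ + 1ℚ + 1ℚ) * u) ⊎ x # y
    go {u} u>0 (N , close) with ∣ d N ∣ <? u + u
    ... | yes small = inj₁ (N , λ {n} h → subst₂ (λ v w → ∣ v ∣ < w)
            (solve 2 (λ a b → a :+ (b :- a) := b) refl (d N) (d n))
            (solve 1 (λ e → (e :+ e) :+ e := (con 1ℚ :+ con 1ℚ :+ con 1ℚ) :* e) refl u)
            (∣+∣< small (close h ℕ.≤-refl)))
    ... | no  large = inj₂ (mk# u u>0 (N , λ {n} h → ≮⇒≥ λ dn<u → large
            (subst (λ v → ∣ v ∣ < u + u)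
              (solve 2 (λ a b → b :+ (a :- b) := a) refl (d N) (d n))
              (∣+∣< dn<u (close ℕ.≤-refl h)))))

  #-tight : ∀ {x y} → ¬ (x # y) → x ≈ y
  #-tight {x} {y} ¬x#y = mk≈ λ ε>0 → Sum.[ (λ near → near) , (λ x#y → ⊥-elim (¬x#y x#y)) ]′
    (near-or-apart x y ε>0)

  #-cotrans : ∀ {x y} → x # y → ∀ z → (x # z) ⊎ (z # y)
  #-cotrans {x} {y} (mk# ε ε>0 far) z = combine (near-or-apart x z ½ε>0) (near-or-apart z y ½ε>0)
    where
    Near : ℝ → ℝ → Set
    Near u v = Eventually λ n → ∣ seq u n - seq v n ∣ < ½ * ε

    ½ε>0 : 0ℚ < ½ * ε
    ½ε>0 = *-pos (positive⁻¹ ½) ε>0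

    triangle : ∀ n → ∣ seq x n - seq z n ∣ < ½ * ε → ∣ seq z n - seq y n ∣ < ½ * ε →
               ∣ seq x n - seq y n ∣ < ε
    triangle n p q = subst₂ (λ u v → ∣ u ∣ < v)
      (solve 3 (λ a b c → (a :- b) :+ (b :- c) := a :- c) refl (seq x n) (seq z n) (seq y n))
      (solve 1 (λ e → con ½ :* e :+ con ½ :* e := e) refl ε)
      (∣+∣< p q)

    combine : Near x z ⊎ x # z → Near z y ⊎ z # y → (x # z) ⊎ (z # y)
    combine (inj₂ x#z)  _           = inj₁ x#z
    combine (inj₁ _)    (inj₂ z#y)  = inj₂ z#y
    combine (inj₁ near) (inj₁ near′) =
      let (n , ε≤ , p , q) = ever (both _,_ far (both _,_ near near′))
      in ⊥-elim (<-irrefl refl (≤-<-trans ε≤ (triangle n p q)))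

  #-respˡ : ∀ {x y z} → x ≈ y → x # z → y # z
  #-respˡ {y = y} x≈y x#z =
    Sum.[ (λ x#y → ⊥-elim (#-irrefl x≈y x#y)) , (λ y#z → y#z) ]′ (#-cotrans x#z y)

  0ᴿ 1ᴿ : ℝ
  0ᴿ = fromℚ 0ℚ
  1ᴿ = fromℚ 1ℚ

  private
    q-0 : ∀ q → q - 0ℚ ≡ q
    q-0 q = solve 1 (λ a → a :- con 0ℚ := a) refl q

  1#0ᴿ : 1ᴿ # 0ᴿ
  1#0ᴿ = mk# 1ℚ 0<1 (0 , λ _ → ≤-refl)

  x-y#0⇒x#y : ∀ {x y} → x -ᴿ y # 0ᴿ → x # y
  x-y#0⇒x#y (mk# ε ε>0 (N , far)) = mk# ε ε>0 (N , λ h → subst (λ u → ε ≤ ∣ u ∣) (q-0 _) (far h))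

  x#y⇒x-y#0 : ∀ {x y} → x # y → x -ᴿ y # 0ᴿ
  x#y⇒x-y#0 (mk# ε ε>0 (N , far)) = mk# ε ε>0 (N , λ h → subst (λ u → ε ≤ ∣ u ∣) (sym (q-0 _)) (far h))

  *#0⇒#0 : ∀ {x y} → x *ᴿ y # 0ᴿ → x # 0ᴿ
  *#0⇒#0 {x} {y} (mk# ε ε>0 far) =
    let (B , B>0 , y≤B) = bounded y in
    mk# (inv B * ε) (*-pos (inv-pos B>0) ε>0) (both (λ {n} → separate n B>0) far y≤B)
    where
    separate : ∀ n {B} → 0ℚ < B → ε ≤ ∣ seq x n * seq y n - 0ℚ ∣ → ∣ seq y n ∣ ≤ B →
               inv B * ε ≤ ∣ seq x n - 0ℚ ∣
    separate n {B} B>0 ε≤ y≤ = ≮⇒≥ λ x< → <-irrefl refl (≤-<-trans ε≤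
      (subst₂ (λ u v → ∣ u ∣ < v)
        (solve 2 (λ a b → b :* (a :- con 0ℚ) := a :* b :- con 0ℚ) refl (seq x n) (seq y n))
        (trans (sym (*-assoc B (inv B) ε))
          (trans (cong (_* ε) (inv-inverse (>0⇒≢0 B>0))) (*-identityˡ ε)))
        (∣*∣< B>0 y≤ x<)))

  private
    square : ∀ q → q * q ≡ ∣ q ∣ * ∣ q ∣
    square q with ∣p∣≡p∨∣p∣≡-p q
    ... | inj₁ eq = sym (cong₂ _*_ eq eq)
    ... | inj₂ eq = trans (solve 1 (λ a → a :* a := (:- a) :* (:- a)) refl q) (sym (cong₂ _*_ eq eq))

    0≤square : ∀ q → 0ℚ ≤ q * q
    0≤square q = subst (0ℚ ≤_) (sym (square q)) (subst (_≤ ∣ q ∣ * ∣ q ∣) (*-zeroʳ (∣ q ∣))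
      (*-monoˡ-≤-nonNeg ∣ q ∣ {{∣-∣-nonNeg q}} (0≤∣p∣ q)))

    square-mono : ∀ {ε q} → 0ℚ < ε → ε ≤ ∣ q ∣ → ε * ε ≤ q * q
    square-mono {ε} {q} ε>0 ε≤ = subst (ε * ε ≤_) (sym (square q)) (≤-trans
      (*-monoʳ-≤-nonNeg ε {{nonNegative (<⇒≤ ε>0)}} ε≤)
      (*-monoˡ-≤-nonNeg ∣ q ∣ {{∣-∣-nonNeg q}} ε≤))

    sum-of-squares : ∀ {ε} p q → ε ≤ p * p → ε ≤ ∣ p * p + q * q - 0ℚ ∣
    sum-of-squares {ε} p q ε≤ = subst (λ u → ε ≤ ∣ u ∣) (sym (q-0 _))
      (subst (ε ≤_) (sym (0≤p⇒∣p∣≡p (+-mono-≤ (0≤square p) (0≤square q))))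
        (subst (_≤ p * p + q * q) (+-identityʳ ε) (+-mono-≤ ε≤ (0≤square q))))

  norm#0 : ∀ {x y} → x # 0ᴿ ⊎ y # 0ᴿ → x *ᴿ x +ᴿ y *ᴿ y # 0ᴿ
  norm#0 {x} {y} (inj₁ (mk# ε ε>0 (N , far))) = mk# (ε * ε) (*-pos ε>0 ε>0) (N , λ {n} h →
    sum-of-squares (seq x n) (seq y n)
      (square-mono ε>0 (subst (λ u → ε ≤ ∣ u ∣) (q-0 (seq x n)) (far h))))
  norm#0 {x} {y} (inj₂ (mk# ε ε>0 (N , far))) = mk# (ε * ε) (*-pos ε>0 ε>0) (N , λ {n} h →
    subst (λ u → ε * ε ≤ ∣ u - 0ℚ ∣) (+-comm (seq y n * seq y n) (seq x n * seq x n))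
      (sum-of-squares (seq y n) (seq x n)
        (square-mono ε>0 (subst (λ u → ε ≤ ∣ u ∣) (q-0 (seq y n)) (far h)))))

  private
    inv-bound : ∀ {ε q} → 0ℚ < ε → ε ≤ ∣ q ∣ → ∣ inv q ∣ ≤ inv ε
    inv-bound {ε} {q} ε>0 ε≤ = *-cancelˡ-≤-pos ε {{positive ε>0}}
      (subst (ε * ∣ inv q ∣ ≤_) eq (*-monoʳ-≤-nonNeg ∣ inv q ∣ {{∣-∣-nonNeg (inv q)}} ε≤))
      where
      eq : ∣ q ∣ * ∣ inv q ∣ ≡ ε * inv ε
      eq = trans (sym (∣p*q∣≡∣p∣*∣q∣ q (inv q)))
           (trans (cong ∣_∣ (inv-inverse (apart⇒≢0 ε>0 ε≤))) (sym (inv-inverse (>0⇒≢0 ε>0))))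

    inv-difference : ∀ {p q} → p ≢ 0ℚ → q ≢ 0ℚ → inv p * (inv q * (q - p)) ≡ inv p - inv q
    inv-difference {p} {q} p≢0 q≢0 = trans
      (solve 4 (λ p q r s → r :* (s :* (q :- p)) := r :* (q :* s) :- s :* (p :* r)) refl p q (inv p) (inv q))
      (cong₂ _-_ (trans (cong (inv p *_) (inv-inverse q≢0)) (*-identityʳ (inv p)))
                 (trans (cong (inv q *_) (inv-inverse p≢0)) (*-identityʳ (inv q))))

  -- The termwise reciprocal; the finitely many terms of x that may vanish are sent to 0.
  recip : ∀ x → x # 0ᴿ → ℝ
  recip x _ .seq n = inv (seq x n)
  recip x (mk# δ δ>0 (N , far)) .cauchy = rescale
    (λ ε → Eventually₂ λ m n → ∣ inv (seq x m) - inv (seq x n) ∣ < ε)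
    (*-pos K>0 K>0) λ {ε} ε>0 →
      both₂ (λ {m} {n} (p , q) r → subst₂ (λ u v → ∣ u ∣ < v)
          (inv-difference (apart⇒≢0 δ>0 p) (apart⇒≢0 δ>0 q))
          (sym (*-assoc (inv δ) (inv δ) ε))
          (∣*∣< K>0 (inv-bound δ>0 p) (∣*∣< K>0 (inv-bound δ>0 q)
            (subst (_< ε) (∣-∣-sym (seq x m) (seq x n)) r))))
        (both₂ _,_ (at₁ far′) (at₂ far′))
        (cauchy x ε>0)
    where
    K>0 = inv-pos δ>0
    far′ : Eventually λ n → δ ≤ ∣ seq x n ∣
    far′ = N , λ {n} h → subst (λ u → δ ≤ ∣ u ∣) (q-0 (seq x n)) (far h)

  recip-inverse : ∀ x x#0 → x *ᴿ recip x x#0 ≈ 1ᴿ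
  recip-inverse x (mk# δ δ>0 (N , far)) = mk≈ λ {ε} ε>0 → N , λ {n} h →
    subst (λ u → ∣ u - 1ℚ ∣ < ε)
      (sym (inv-inverse (apart⇒≢0 δ>0 (subst (λ u → δ ≤ ∣ u ∣) (q-0 (seq x n)) (far h))))) ε>0

module Complex where

  open Real using (ℝ; seq; fromℚ; _+ᴿ_; -ᴿ_; _-ᴿ_; _*ᴿ_; 0ᴿ; 1ᴿ; pointwise)
  open import Data.Rational.Base as ℚ using (ℚ; 0ℚ; 1ℚ)
  import Data.Rational.Properties as ℚ
  open import Data.Rational.Solver using (module +-*-Solver)
  open +-*-Solver using (solve; _:=_; _:+_; _:*_; :-_; _:-_; con)

  record ℂ : Set where
    constructor _+i_
    field
      re im : ℝ

  open ℂ public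

  infix 4 _≈_ _#_

  record _≈_ (z w : ℂ) : Set where
    constructor _,_
    field
      re≈ : re z Real.≈ re w
      im≈ : im z Real.≈ im w

  data _#_ (z w : ℂ) : Set where
    re# : re z Real.# re w → z # w
    im# : im z Real.# im w → z # w

  infixl 6 _+_
  infixl 7 _*_
  infix  8 -_

  0ᶜ 1ᶜ : ℂ
  0ᶜ = 0ᴿ +i 0ᴿ
  1ᶜ = 1ᴿ +i 0ᴿ

  _+_ _*_ : ℂ → ℂ → ℂ
  (z + w) .re = re z +ᴿ re w
  (z + w) .im = im z +ᴿ im w
  (z * w) .re = re z *ᴿ re w -ᴿ im z *ᴿ im w
  (z * w) .im = re z *ᴿ im w +ᴿ im z *ᴿ re w

  -_ : ℂ → ℂ
  (- z) .re = -ᴿ (re z)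
  (- z) .im = -ᴿ (im z)

  private
    norm : ℂ → ℝ
    norm z = re z *ᴿ re z +ᴿ im z *ᴿ im z

    norm#0 : ∀ {z} → z # 0ᶜ → norm z Real.# 0ᴿ
    norm#0 {z} (re# p) = Real.norm#0 {re z} {im z} (inj₁ p)
    norm#0 {z} (im# p) = Real.norm#0 {re z} {im z} (inj₂ p)

  -- The reciprocal: the conjugate of z over the squared modulus of z.
  inv : ∀ z → z # 0ᶜ → ℂ
  inv z z#0 .re = re z *ᴿ Real.recip (norm z) (norm#0 {z} z#0)
  inv z z#0 .im = -ᴿ (im z *ᴿ Real.recip (norm z) (norm#0 {z} z#0))

  private
    ≈-sym : ∀ {z w} → z ≈ w → w ≈ z
    ≈-sym (p , q) = Real.≈-sym p , Real.≈-sym q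

    ≈-trans : ∀ {z w v} → z ≈ w → w ≈ v → z ≈ v
    ≈-trans (p , q) (r , s) = Real.≈-trans p r , Real.≈-trans q s

    *-cong : ∀ {z z′ w w′} → z ≈ z′ → w ≈ w′ → z * w ≈ z′ * w′
    *-cong {a +i b} {a′ +i b′} {c +i d} {c′ +i d′} (p , q) (r , s) =
        Real.+-congᴿ {a *ᴿ c} {a′ *ᴿ c′} { -ᴿ (b *ᴿ d)} { -ᴿ (b′ *ᴿ d′)}
          (Real.*-congᴿ {a} {a′} {c} {c′} p r)
          (Real.-‿congᴿ {b *ᴿ d} {b′ *ᴿ d′} (Real.*-congᴿ {b} {b′} {d} {d′} q s))
      , Real.+-congᴿ {a *ᴿ d} {a′ *ᴿ d′} {b *ᴿ c} {b′ *ᴿ c′}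
          (Real.*-congᴿ {a} {a′} {d} {d′} p s)
          (Real.*-congᴿ {b} {b′} {c} {c′} q r)

    *-comm : ∀ z w → z * w ≈ w * z
    *-comm (a +i b) (c +i d) =
        pointwise (λ n → solve 4 (λ a b c d → a :* c :- b :* d := c :* a :- d :* b) refl
                           (seq a n) (seq b n) (seq c n) (seq d n))
      , pointwise (λ n → solve 4 (λ a b c d → a :* d :+ b :* c := c :* b :+ d :* a) refl
                           (seq a n) (seq b n) (seq c n) (seq d n))

    *-assoc : ∀ z w v → (z * w) * v ≈ z * (w * v)
    *-assoc (a +i b) (c +i d) (e +i f) =
        pointwise (λ n → solve 6 (λ a b c d e f →
            (a :* c :- b :* d) :* e :- (a :* d :+ b :* c) :* f
              := a :* (c :* e :- d :* f) :- b :* (c :* f :+ d :* e)) refl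
            (seq a n) (seq b n) (seq c n) (seq d n) (seq e n) (seq f n))
      , pointwise (λ n → solve 6 (λ a b c d e f →
            (a :* c :- b :* d) :* f :+ (a :* d :+ b :* c) :* e
              := a :* (c :* f :+ d :* e) :+ b :* (c :* e :- d :* f)) refl
            (seq a n) (seq b n) (seq c n) (seq d n) (seq e n) (seq f n))

    *-identityˡ : ∀ z → 1ᶜ * z ≈ z
    *-identityˡ (a +i b) =
        pointwise (λ n → solve 2 (λ a b → con 1ℚ :* a :- con 0ℚ :* b := a) refl (seq a n) (seq b n))
      , pointwise (λ n → solve 2 (λ a b → con 1ℚ :* b :+ con 0ℚ :* a := b) refl (seq a n) (seq b n))

    distribˡ : ∀ z w v → z * (w + v) ≈ z * w + z * v
    distribˡ (a +i b) (c +i d) (e +i f) =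
        pointwise (λ n → solve 6 (λ a b c d e f →
            a :* (c :+ e) :- b :* (d :+ f) := (a :* c :- b :* d) :+ (a :* e :- b :* f)) refl
            (seq a n) (seq b n) (seq c n) (seq d n) (seq e n) (seq f n))
      , pointwise (λ n → solve 6 (λ a b c d e f →
            a :* (d :+ f) :+ b :* (c :+ e) := (a :* d :+ b :* c) :+ (a :* f :+ b :* e)) refl
            (seq a n) (seq b n) (seq c n) (seq d n) (seq e n) (seq f n))

    +-cong : ∀ {z z′ w w′} → z ≈ z′ → w ≈ w′ → z + w ≈ z′ + w′
    +-cong {a +i b} {a′ +i b′} {c +i d} {c′ +i d′} (p , q) (r , s) =
      Real.+-congᴿ {a} {a′} {c} {c′} p r , Real.+-congᴿ {b} {b′} {d} {d′} q s

    -‿cong : ∀ {z w} → z ≈ w → - z ≈ - w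
    -‿cong {a +i b} {c +i d} (p , q) = Real.-‿congᴿ {a} {c} p , Real.-‿congᴿ {b} {d} q

    +-assoc : ∀ z w v → (z + w) + v ≈ z + (w + v)
    +-assoc (a +i b) (c +i d) (e +i f) =
        pointwise (λ n → ℚ.+-assoc (seq a n) (seq c n) (seq e n))
      , pointwise (λ n → ℚ.+-assoc (seq b n) (seq d n) (seq f n))

    +-comm : ∀ z w → z + w ≈ w + z
    +-comm (a +i b) (c +i d) =
      pointwise (λ n → ℚ.+-comm (seq a n) (seq c n)) , pointwise (λ n → ℚ.+-comm (seq b n) (seq d n))

    +-identityˡ : ∀ z → 0ᶜ + z ≈ z
    +-identityˡ (a +i b) =
      pointwise (λ n → ℚ.+-identityˡ (seq a n)) , pointwise (λ n → ℚ.+-identityˡ (seq b n))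

    -‿inverseˡ : ∀ z → (- z) + z ≈ 0ᶜ
    -‿inverseˡ (a +i b) =
      pointwise (λ n → ℚ.+-inverseˡ (seq a n)) , pointwise (λ n → ℚ.+-inverseˡ (seq b n))

  inv-inverse : ∀ z z#0 → z * inv z z#0 ≈ 1ᶜ
  inv-inverse z@(a +i b) z#0 =
      Real.≈-trans {a *ᴿ (a *ᴿ r) -ᴿ b *ᴿ (-ᴿ (b *ᴿ r))} {norm z *ᴿ r} {1ᴿ}
        (pointwise (λ n → solve 3 (λ a b r →
            a :* (a :* r) :- b :* (:- (b :* r)) := (a :* a :+ b :* b) :* r) refl
            (seq a n) (seq b n) (seq r n)))
        (Real.recip-inverse (norm z) (norm#0 {z} z#0))
    , pointwise (λ n → solve 3 (λ a b r →
            a :* (:- (b :* r)) :+ b :* (a :* r) := con 0ℚ) refl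
            (seq a n) (seq b n) (seq r n))
    where r = Real.recip (norm z) (norm#0 {z} z#0)

  private
    -- re z · re w - im z · im w ≈ 1 is apart from 0, so re z or im z is.
    unit⇒#0 : ∀ {z w} → z * w ≈ 1ᶜ → z # 0ᶜ
    unit⇒#0 {a +i b} {c +i d} (p , _) = Sum.[ (λ ac#0 → re# (Real.*#0⇒#0 {a} {c} ac#0))
                                            , (λ 0#bd → im# (Real.*#0⇒#0 {b} {d} (Real.#-sym {0ᴿ} {b *ᴿ d} 0#bd)))
                                            ]′ (Real.#-cotrans {a *ᴿ c} {b *ᴿ d} ac#bd 0ᴿ)
      where
      ac#bd : a *ᴿ c Real.# b *ᴿ d
      ac#bd = Real.x-y#0⇒x#y {a *ᴿ c} {b *ᴿ d}
        (Real.#-respˡ {1ᴿ} {a *ᴿ c -ᴿ b *ᴿ d} {0ᴿ}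
          (Real.≈-sym {a *ᴿ c -ᴿ b *ᴿ d} {1ᴿ} p) Real.1#0ᴿ)

    x-y#0⇒x#y : ∀ {z w} → (z + (- w)) # 0ᶜ → z # w
    x-y#0⇒x#y {a +i b} {c +i d} (re# p) = re# (Real.x-y#0⇒x#y {a} {c} p)
    x-y#0⇒x#y {a +i b} {c +i d} (im# p) = im# (Real.x-y#0⇒x#y {b} {d} p)

    x#y⇒x-y#0 : ∀ {z w} → z # w → (z + (- w)) # 0ᶜ
    x#y⇒x-y#0 {a +i b} {c +i d} (re# p) = re# (Real.x#y⇒x-y#0 {a} {c} p)
    x#y⇒x-y#0 {a +i b} {c +i d} (im# p) = im# (Real.x#y⇒x-y#0 {b} {d} p)

    #-cotrans : ∀ {z w} → z # w → ∀ v → (z # v) ⊎ (v # w)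
    #-cotrans (re# p) v = Sum.map re# re# (Real.#-cotrans p (re v))
    #-cotrans (im# p) v = Sum.map im# im# (Real.#-cotrans p (im v))

    #-irrefl : ∀ {z w} → z ≈ w → ¬ (z # w)
    #-irrefl (p , q) (re# r) = Real.#-irrefl p r
    #-irrefl (p , q) (im# r) = Real.#-irrefl q r

    #-sym : ∀ {z w} → z # w → w # z
    #-sym (re# p) = re# (Real.#-sym p)
    #-sym (im# p) = im# (Real.#-sym p)

    unit : ∀ {z w} → z # w → ∃[ v ] (v * (z + (- w)) ≈ 1ᶜ × (z + (- w)) * v ≈ 1ᶜ)
    unit {z} {w} z#w = v , ≈-trans {v * d} {d * v} {1ᶜ} (*-comm v d) dv≈1 , dv≈1
      where
      d = z + (- w)
      d#0 = x#y⇒x-y#0 {z} {w} z#w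
      v = inv d d#0
      dv≈1 = inv-inverse d d#0

    *-identityʳ : ∀ z → z * 1ᶜ ≈ z
    *-identityʳ z = ≈-trans {z * 1ᶜ} {1ᶜ * z} {z} (*-comm z 1ᶜ) (*-identityˡ z)

    distribʳ : ∀ z w v → (w + v) * z ≈ w * z + v * z
    distribʳ z w v = ≈-trans {(w + v) * z} {z * (w + v)} {w * z + v * z} (*-comm (w + v) z)
      (≈-trans {z * (w + v)} {z * w + z * v} {w * z + v * z} (distribˡ z w v)
        (+-cong {z * w} {w * z} {z * v} {v * z} (*-comm z w) (*-comm z v)))

    +-identityʳ : ∀ z → z + 0ᶜ ≈ z
    +-identityʳ z = ≈-trans {z + 0ᶜ} {0ᶜ + z} {z} (+-comm z 0ᶜ) (+-identityˡ z)

    -‿inverseʳ : ∀ z → z + (- z) ≈ 0ᶜ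
    -‿inverseʳ z = ≈-trans {z + (- z)} { - z + z} {0ᶜ} (+-comm z (- z)) (-‿inverseˡ z)

  heytingField : HeytingField 0ℓ 0ℓ 0ℓ
  heytingField = record
    { Carrier = ℂ
    ; _≈_ = _≈_
    ; _#_ = _#_
    ; _+_ = _+_
    ; _*_ = _*_
    ; -_ = -_
    ; 0# = 0ᶜ
    ; 1# = 1ᶜ
    ; isHeytingField = record
      { isHeytingCommutativeRing = record
        { isCommutativeRing = record
          { isRing = record
            { +-isAbelianGroup = record
              { isGroup = record
                { isMonoid = record
                  { isSemigroup = record
                    { isMagma = record
                      { isEquivalence = record
                        { refl  = pointwise (λ _ → refl) , pointwise (λ _ → refl)
                        ; sym   = ≈-sym
                        ; trans = ≈-trans
                        }
                      ; ∙-cong = λ {z} {z′} {w} {w′} → +-cong {z} {z′} {w} {w′}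
                      }
                    ; assoc = +-assoc
                    }
                  ; identity = +-identityˡ , +-identityʳ
                  }
                ; inverse = -‿inverseˡ , -‿inverseʳ
                ; ⁻¹-cong = λ {z} {w} → -‿cong {z} {w}
                }
              ; comm = +-comm
              }
            ; *-cong = λ {z} {z′} {w} {w′} → *-cong {z} {z′} {w} {w′}
            ; *-assoc = *-assoc
            ; *-identity = *-identityˡ , *-identityʳ
            ; distrib = distribˡ , distribʳ
            }
          ; *-comm = *-comm
          }
        ; isApartnessRelation = record
          { irrefl  = #-irrefl
          ; sym     = #-sym
          ; cotrans = #-cotrans
          }
        ; #⇒invertible = λ {z} {w} → unit {z} {w}
        ; invertible⇒# = λ {z} {w} (v , _ , p) → x-y#0⇒x#y {z} {w} (unit⇒#0 {z + (- w)} {v} p)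
        }
      ; tight = λ z w →
            (λ ¬z#w → Real.#-tight (λ p → ¬z#w (re# p)) , Real.#-tight (λ p → ¬z#w (im# p)))
          , #-irrefl
      }
    }

  fromℤ : ℤ → ℂ
  fromℤ i = fromℚ (i ℚ./ 1) +i 0ᴿ

open Complex public using (ℂ; fromℤ; inv; inv-inverse)
open HeytingField Complex.heytingField public
  using (_≈_; _#_; _+_; _*_; -_; _-_; 0#; 1#)

commutativeRing : CommutativeRing 0ℓ 0ℓ
commutativeRing = HeytingCommutativeRing.commutativeRing
  (HeytingField.heytingCommutativeRing Complex.heytingField)

open CommutativeRing commutativeRing using (semiring; +-monoid)
open import Algebra.Properties.Semiring.Exp semiring public using (_^_)
open import Algebra.Properties.Monoid.Sum +-monoid public using (sum⁺-syntax)

fromℕ : ℕ → ℂ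
fromℕ n = fromℤ (+ n)

-- (-1)^i for an integer exponent i; as (-1)⁻¹ = -1, only ∣ i ∣ matters.
-1^_ : ℤ → ℂ
-1^ i = (- 1#) ^ ℤ.∣ i ∣

IsGeneralizedFibonacci : (ℤ → ℂ) → Set
IsGeneralizedFibonacci G = ∀ m → G (m ℤ.+ + 2) ≈ G (m ℤ.+ + 1) + G m

-- Lucas numbers at all integer indices: the recurrence is run forwards for
-- nonnegative indices, and backwards, L₋₍ₙ₊₂₎ = L₋ₙ - L₋₍ₙ₊₁₎, for negative ones.
L : ℤ → ℤ
L (+ 0)                = + 2
L (+ 1)                = + 1
L (+ (suc (suc n)))    = L (+ (suc n)) ℤ.+ L (+ n)
L -[1+ 0 ]             = ℤ.- (+ 1)
L -[1+ 1 ]             = L (+ 0) ℤ.- L -[1+ 0 ]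
L -[1+ (suc (suc n)) ] = L -[1+ n ] ℤ.- L -[1+ (suc n) ]

P : (G : ℤ → ℂ) (a b : ℤ) (x : ℂ) (v w : ℕ) → ℂ
P G a b x v w =
  ∑[ k ≤ v ] ( fromℕ (v C toℕ k) * (-1^ ((b ℤ.+ + 1) ℤ.* + toℕ k)) * x ^ toℕ k
             * G (a ℤ.+ b ℤ.* + w ℤ.- b ℤ.* + toℕ k) )

Δ : ℤ → ℂ → ℂ
Δ b x = 1# - fromℤ (L b) * x + (-1^ b) * x ^ 2

{-# OPTIONS --safe #-}

-- Let u j = G (a + b j). Since G (m + b) + (-1)ᵇ G (m - b) = L_b G m, the shift operator E
-- satisfies E + (-1)ᵇ E⁻¹ = L_b on u, so that (1 - x E) (1 - (-1)ᵇ x E⁻¹) = Δ. As P(v, ·) is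
-- (1 - (-1)ᵇ x E⁻¹)ᵛ u, the sequences c v = Δ⁻ᵛ P(v, ·) satisfy c v = (1 - x E) (c (v + 1)),
-- and the sum of xᵏ k² u k is obtained by summing by parts three times.
module Submission where

open import Algebra.Bundles using (CommutativeRing)
open import Algebra.Solver.Ring.AlmostCommutativeRing
  using (fromCommutativeRing; _-Raw-AlmostCommutative⟶_)
open import Data.Fin.Base using (toℕ)
import Data.Fin.Properties as Fin
open import Data.Integer.Base as ℤ using (ℤ; +_; -[1+_])
import Data.Integer.Properties as ℤ
import Data.Integer.Tactic.RingSolver as ℤ
open import Data.Maybe.Base using (just; nothing)
open import Data.Nat.Base as ℕ using (ℕ; zero; suc)
open import Data.Nat.Combinatorics using (_C_)
open import Data.Nat.GeneralisedArithmetic using (fold)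
import Data.Nat.Properties as ℕ
import Data.Nat.Tactic.RingSolver as ℕ
import Data.Rational.Base as ℚ
import Data.Rational.Properties as ℚ
open import Data.Rational.Solver using (module +-*-Solver)
import Data.Rational.Unnormalised.Base as ℚᵘ
import Data.Rational.Unnormalised.Properties as ℚᵘ
open import Relation.Binary.Definitions using (WeaklyDecidable)
open import Relation.Binary.PropositionalEquality as ≡ using (_≡_)
open import Relation.Nullary.Decidable.Core using (yes; no)

open import Defs using (L)

-- Lucas recurrence and index arithmetic over ℤ.

L-recurrence : ∀ m → L (m ℤ.+ + 2) ≡ L (m ℤ.+ + 1) ℤ.+ L m
L-recurrence (+ n) rewrite ℕ.+-comm n 2 | ℕ.+-comm n 1 = ≡.refl
L-recurrence -[1+ 0 ] = ≡.refl
L-recurrence -[1+ 1 ] = ≡.refl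
-- This clause of `L` is the recurrence solved for its last term.
L-recurrence -[1+ suc (suc n) ] = cancel (L -[1+ n ]) (L -[1+ suc n ])
  where
  cancel : ∀ i j → i ≡ j ℤ.+ (i ℤ.- j)
  cancel = ℤ.solve-∀

-- The iterated `pred` stands in for subtracting `k`: for a literal `k` it unfolds by computation to
-- the shifts that occur in `differences`.
progression-index : ∀ a b w k →
  a ℤ.+ b ℤ.* w ℤ.- b ℤ.* + k ≡ a ℤ.+ b ℤ.* fold w ℤ.pred k
progression-index a b w zero = base a b w
  where
  base : ∀ a b w → a ℤ.+ b ℤ.* w ℤ.- b ℤ.* + 0 ≡ a ℤ.+ b ℤ.* w
  base = ℤ.solve-∀
progression-index a b w (suc k) = ≡.trans (split a b w (+ k))
  (≡.trans (≡.cong (ℤ._- b) (progression-index a b w k)) (merge a b (fold w ℤ.pred k)))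
  where
  split : ∀ a b w k → a ℤ.+ b ℤ.* w ℤ.- b ℤ.* (+ 1 ℤ.+ k) ≡ a ℤ.+ b ℤ.* w ℤ.- b ℤ.* k ℤ.- b
  split = ℤ.solve-∀
  merge : ∀ a b j → a ℤ.+ b ℤ.* j ℤ.- b ≡ a ℤ.+ b ℤ.* (ℤ.- + 1 ℤ.+ j)
  merge = ℤ.solve-∀

-- Only ring laws, integer coefficients and an inverse of `δ` enter, so ℂ is replaced by a
-- commutative ring with a homomorphism from ℤ, which also supplies the coefficients of the ring
-- solver.
module IntegerAlgebra {r ℓ} (R : CommutativeRing r ℓ)
  (homomorphism : ℤ.+-*-rawRing -Raw-AlmostCommutative⟶ fromCommutativeRing R) where

  open CommutativeRing R
  open _-Raw-AlmostCommutative⟶_ homomorphism renaming (⟦_⟧ to ι)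
  open import Algebra.Properties.Semiring.Exp semiring using (_^_; ^-congˡ; ^-congʳ; ^-assocʳ)
  open import Algebra.Properties.CommutativeSemiring.Exp commutativeSemiring using (^-distrib-*)
  open import Algebra.Properties.Monoid.Sum +-monoid
    using (sum-syntax; sum⁺-syntax; sum-cong-≋; sum-cong-≗; sum-init-last)
  open import Algebra.Properties.Ring ring using (-‿distribˡ-*; -‿involutive; -1*x≈-x; +-cancelˡ)
  import Relation.Binary.Reasoning.Setoid setoid as ≈-Reasoning

  private
    coefficient-≟ : WeaklyDecidable (λ i j → ι i ≈ ι j)
    coefficient-≟ i j with i ℤ.≟ j
    ... | yes i≡j = just (reflexive (≡.cong ι i≡j))
    ... | no _    = nothing

  open import Algebra.Solver.Ring ℤ.+-*-rawRing (fromCommutativeRing R) homomorphism coefficient-≟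
    using (solve; _:=_; _:+_; _:*_; _:-_; :-_; _:^_; con)

  -- Signs `(-1)^i` for integer exponents.

  sgn : ℤ → Carrier
  sgn i = (- 1#) ^ ℤ.∣ i ∣

  sgn-+1 : ∀ i → sgn (i ℤ.+ + 1) ≈ - sgn i
  sgn-+1 (+ n) = trans (^-congʳ (- 1#) (ℕ.+-comm n 1)) (-1*x≈-x (sgn (+ n)))
  sgn-+1 -[1+ n ] = trans (^-congʳ (- 1#) (step n))
    (trans (sym (-‿involutive (sgn (+ n)))) (-‿cong (sym (-1*x≈-x (sgn (+ n))))))
    where
    step : ∀ n → ℤ.∣ -[1+ n ] ℤ.+ + 1 ∣ ≡ n
    step zero    = ≡.refl
    step (suc n) = ≡.refl

  sgn-square : ∀ i → sgn i * sgn i ≈ 1#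
  sgn-square i = square ℤ.∣ i ∣
    where
    square : ∀ n → (- 1#) ^ n * (- 1#) ^ n ≈ 1#
    square zero    = *-identityˡ 1#
    square (suc n) = trans
      -- `e :^ 0` evaluates to `1#` by computation, whereas `con (+ 1)` would denote `ι (+ 1)`,
      -- which is only provably equal to it.
      (solve 1 (λ e → (:- (e :^ 0) :* e) :* (:- (e :^ 0) :* e) := e :* e) refl ((- 1#) ^ n))
      (square n)

  sgn-* : ∀ i k → sgn (i ℤ.* + k) ≈ sgn i ^ k
  sgn-* i k = trans (^-congʳ (- 1#) (ℤ.abs-* i (+ k))) (sym (^-assocʳ (- 1#) ℤ.∣ i ∣ k))

  -- Fibonacci sequences and their relation to Lucas numbers.

  Fibonacci : (ℤ → Carrier) → Set ℓ
  Fibonacci f = ∀ m → f (m ℤ.+ + 2) ≈ f (m ℤ.+ + 1) + f m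

  -- The recurrence determines each next value and, after cancelling the middle term, each previous
  -- one, so two neighbouring values fix the whole sequence.
  Fibonacci-unique : ∀ {f g} → Fibonacci f → Fibonacci g →
    f (+ 0) ≈ g (+ 0) → f (+ 1) ≈ g (+ 1) → ∀ m → f m ≈ g m
  Fibonacci-unique {f} {g} F G f0≈g0 f1≈g1 = agree
    where
    up : ∀ n → f (+ n) ≈ g (+ n) → f (+ suc n) ≈ g (+ suc n) → f (+ suc (suc n)) ≈ g (+ suc (suc n))
    up n p q with F (+ n) | G (+ n)
    ... | s | t rewrite ℕ.+-comm n 2 | ℕ.+-comm n 1 = trans s (trans (+-cong q p) (sym t))

    down : ∀ m → f (m ℤ.+ + 2) ≈ g (m ℤ.+ + 2) → f (m ℤ.+ + 1) ≈ g (m ℤ.+ + 1) → f m ≈ g m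
    down m p q = +-cancelˡ (f (m ℤ.+ + 1)) (f m) (g m)
      (trans (sym (F m)) (trans p (trans (G m) (+-congʳ (sym q)))))

    agree : ∀ m → f m ≈ g m
    agree (+ 0)                = f0≈g0
    agree (+ 1)                = f1≈g1
    agree (+ suc (suc n))      = up n (agree (+ n)) (agree (+ suc n))
    agree -[1+ 0 ]             = down -[1+ 0 ] f1≈g1 f0≈g0
    agree -[1+ 1 ]             = down -[1+ 1 ] f0≈g0 (agree -[1+ 0 ])
    agree -[1+ suc (suc n) ]   = down -[1+ suc (suc n) ] (agree -[1+ n ]) (agree -[1+ suc n ])

  -- Both sides are Fibonacci sequences in b which agree at b = 0 and b = 1.
  Lucas-three-term : ∀ {G} → Fibonacci G → ∀ m b →
    G (m ℤ.+ b) + sgn b * G (m ℤ.- b) ≈ ι (L b) * G m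
  Lucas-three-term {G} fib m = Fibonacci-unique lhs-Fibonacci rhs-Fibonacci at-0 at-1
    where
    G-cong : ∀ {i j} → i ≡ j → G i ≈ G j
    G-cong i≡j = reflexive (≡.cong G i≡j)

    rhs-Fibonacci : Fibonacci (λ b → ι (L b) * G m)
    rhs-Fibonacci b = trans
      (*-congʳ (trans (reflexive (≡.cong ι (L-recurrence b))) (+-homo (L (b ℤ.+ + 1)) (L b))))
      (distribʳ (G m) (ι (L (b ℤ.+ + 1))) (ι (L b)))

    forwards : ∀ b → G (m ℤ.+ (b ℤ.+ + 2)) ≈ G (m ℤ.+ (b ℤ.+ + 1)) + G (m ℤ.+ b)
    forwards b = trans (G-cong (≡.sym (ℤ.+-assoc m b (+ 2))))
      (trans (fib (m ℤ.+ b)) (+-congʳ (G-cong (ℤ.+-assoc m b (+ 1)))))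

    backwards : ∀ b → G (m ℤ.- b) ≈ G (m ℤ.- (b ℤ.+ + 1)) + G (m ℤ.- (b ℤ.+ + 2))
    backwards b = trans (G-cong (eq₂ m b))
      (trans (fib (m ℤ.- (b ℤ.+ + 2))) (+-congʳ (G-cong (eq₁ m b))))
      where
      eq₂ : ∀ m b → m ℤ.- b ≡ m ℤ.- (b ℤ.+ + 2) ℤ.+ + 2
      eq₂ = ℤ.solve-∀
      eq₁ : ∀ m b → m ℤ.- (b ℤ.+ + 2) ℤ.+ + 1 ≡ m ℤ.- (b ℤ.+ + 1)
      eq₁ = ℤ.solve-∀

    sgn-+2 : ∀ b → sgn (b ℤ.+ + 2) ≈ sgn b
    sgn-+2 b = trans (reflexive (≡.cong sgn (≡.sym (ℤ.+-assoc b (+ 1) (+ 1)))))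
      (trans (sgn-+1 (b ℤ.+ + 1)) (trans (-‿cong (sgn-+1 b)) (-‿involutive (sgn b))))

    lhs-Fibonacci : Fibonacci (λ b → G (m ℤ.+ b) + sgn b * G (m ℤ.- b))
    lhs-Fibonacci b = begin
      G (m ℤ.+ (b ℤ.+ + 2)) + sgn (b ℤ.+ + 2) * G₂
        ≈⟨ +-cong (forwards b) (*-congʳ (sgn-+2 b)) ⟩
      (G (m ℤ.+ (b ℤ.+ + 1)) + G (m ℤ.+ b)) + sgn b * G₂
        -- Since `sgn (b + 1)` is `- sgn b`, the two `G₁` terms cancel; this sign change makes
        -- `sgn b * G (m - b)` obey the forward recurrence although its index descends.
        ≈⟨ solve 5 (λ p q e g₁ g₂ → (p :+ q) :+ e :* g₂ := (p :+ (:- e) :* g₁) :+ (q :+ e :* (g₁ :+ g₂)))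
             refl (G (m ℤ.+ (b ℤ.+ + 1))) (G (m ℤ.+ b)) (sgn b) G₁ G₂ ⟩
      (G (m ℤ.+ (b ℤ.+ + 1)) + (- sgn b) * G₁) + (G (m ℤ.+ b) + sgn b * (G₁ + G₂))
        ≈⟨ +-cong (+-congˡ (*-congʳ (sgn-+1 b))) (+-congˡ (*-congˡ (backwards b))) ⟨
      (G (m ℤ.+ (b ℤ.+ + 1)) + sgn (b ℤ.+ + 1) * G₁) + (G (m ℤ.+ b) + sgn b * G (m ℤ.- b)) ∎
      where
      open ≈-Reasoning
      G₁ = G (m ℤ.- (b ℤ.+ + 1))
      G₂ = G (m ℤ.- (b ℤ.+ + 2))

    at-0 : G (m ℤ.+ + 0) + sgn (+ 0) * G (m ℤ.- + 0) ≈ ι (L (+ 0)) * G m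
    at-0 = trans (+-cong (G-cong (ℤ.+-identityʳ m)) (*-congˡ (G-cong (ℤ.+-identityʳ m))))
      (solve 1 (λ g → g :+ g :^ 0 :* g := con (+ 2) :* g) refl (G m))

    at-1 : G (m ℤ.+ + 1) + sgn (+ 1) * G (m ℤ.- + 1) ≈ ι (L (+ 1)) * G m
    at-1 = begin
      G (m ℤ.+ + 1) + sgn (+ 1) * g₋
        ≈⟨ +-congʳ (trans (G-cong (eq₂ m)) (trans (fib (m ℤ.- + 1)) (+-congʳ (G-cong (eq₁ m))))) ⟩
      (G m + g₋) + sgn (+ 1) * g₋
        ≈⟨ solve 2 (λ g h → (g :+ h) :+ (:- (g :^ 0)) :^ 1 :* h := con (+ 1) :* g) refl (G m) g₋ ⟩
      ι (+ 1) * G m ∎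
      where
      open ≈-Reasoning
      g₋ = G (m ℤ.- + 1)
      eq₂ : ∀ m → m ℤ.+ + 1 ≡ m ℤ.- + 1 ℤ.+ + 2
      eq₂ = ℤ.solve-∀
      eq₁ : ∀ m → m ℤ.- + 1 ℤ.+ + 1 ≡ m
      eq₁ = ℤ.solve-∀

  -- Sums of squares weighted by powers of `x`.

  -- Summation by parts: c (suc v) is the x-weighted tail sum of c v.
  squares-sum : ∀ (c : ℕ → ℕ → Carrier) x →
    (∀ v n → c (suc v) n ≈ c v n + x * c (suc v) (suc n)) → ∀ n →
    ∑[ k < n ] (x ^ toℕ k * ι (+ toℕ k) ^ 2 * c 0 (toℕ k))
      ≈ - (ι (+ n) ^ 2 * x ^ n * c 1 n)
        - ((ι (+ 2) * ι (+ n) + ι (+ 1)) * x ^ (1 ℕ.+ n) * c 2 (1 ℕ.+ n) - x * c 2 1)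
        - ι (+ 2) * (x ^ (2 ℕ.+ n) * c 3 (2 ℕ.+ n) - x ^ 2 * c 3 2)
  squares-sum c x step = go
    where
    open ≈-Reasoning

    summand : ℕ → Carrier
    summand k = x ^ k * ι (+ k) ^ 2 * c 0 k

    sum-snoc : ∀ n → ∑[ k < suc n ] summand (toℕ k) ≈ ∑[ k < n ] summand (toℕ k) + summand n
    sum-snoc n = trans (sum-init-last {n} (λ k → summand (toℕ k)))
      (+-cong (reflexive (sum-cong-≗ {n} (λ k → ≡.cong summand (Fin.toℕ-inject₁ k))))
              (reflexive (≡.cong summand (Fin.toℕ-fromℕ n))))

    go : ∀ n → ∑[ k < n ] summand (toℕ k)
      ≈ - (ι (+ n) ^ 2 * x ^ n * c 1 n)
        - ((ι (+ 2) * ι (+ n) + ι (+ 1)) * x ^ (1 ℕ.+ n) * c 2 (1 ℕ.+ n) - x * c 2 1)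
        - ι (+ 2) * (x ^ (2 ℕ.+ n) * c 3 (2 ℕ.+ n) - x ^ 2 * c 3 2)
    -- At zero the first term has the factor `0 ^ 2`, and each bracket is a boundary value minus
    -- itself.
    go zero = trans (sym 0-homo)
      (solve 4 (λ x c₁ c₂ c₃ →
          con (+ 0) := :- (con (+ 0) :^ 2 :* x :^ 0 :* c₁)
            :- ((con (+ 2) :* con (+ 0) :+ con (+ 1)) :* x :^ 1 :* c₂ :- x :* c₂)
            :- con (+ 2) :* (x :^ 2 :* c₃ :- x :^ 2 :* c₃))
        refl x (c 1 0) (c 2 1) (c 3 2))
    go (suc n) = begin
      ∑[ k < suc n ] summand (toℕ k)
        ≈⟨ trans (sum-snoc n) (+-congʳ (go n)) ⟩
      - (ν ^ 2 * x ^ n * c 1 n)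
        - ((ι (+ 2) * ν + ι (+ 1)) * x ^ (1 ℕ.+ n) * c 2 (1 ℕ.+ n) - x * c 2 1)
        - ι (+ 2) * (x ^ (2 ℕ.+ n) * c 3 (2 ℕ.+ n) - x ^ 2 * c 3 2)
        + summand n
        -- Each boundary term moves one index forward; this splits off `c 0 n`, which cancels the
        -- new summand, and passes the rest to the next level.
        ≈⟨ +-congʳ (+-cong (+-cong (-‿cong (*-congˡ (step 0 n))) (-‿cong (+-congʳ (*-congˡ (step 1 (1 ℕ.+ n))))))
                           (-‿cong (*-congˡ (+-congʳ (*-congˡ (step 2 (2 ℕ.+ n))))))) ⟩
      - (ν ^ 2 * x ^ n * (c 0 n + x * d₁))
        - ((ι (+ 2) * ν + ι (+ 1)) * x ^ (1 ℕ.+ n) * (d₁ + x * d₂) - x * c 2 1)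
        - ι (+ 2) * (x ^ (2 ℕ.+ n) * (d₂ + x * d₃) - x ^ 2 * c 3 2)
        + summand n
        -- The coefficients match since `(n + 1)^2 - n^2` is `2 n + 1`, whose own difference is `2`.
        -- `X` stands for `x ^ n`, as the higher powers unfold to products with it.
        ≈⟨ solve 9 (λ x X ν c₀ d₁ d₂ d₃ e₂ e₃ →
             :- (ν :^ 2 :* X :* (c₀ :+ x :* d₁))
               :- ((con (+ 2) :* ν :+ con (+ 1)) :* (x :* X) :* (d₁ :+ x :* d₂) :- x :* e₂)
               :- con (+ 2) :* (x :* (x :* X) :* (d₂ :+ x :* d₃) :- x :^ 2 :* e₃)
               :+ X :* ν :^ 2 :* c₀
             := :- ((con (+ 1) :+ ν) :^ 2 :* (x :* X) :* d₁)
               :- ((con (+ 2) :* (con (+ 1) :+ ν) :+ con (+ 1)) :* (x :* (x :* X)) :* d₂ :- x :* e₂)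
               :- con (+ 2) :* (x :* (x :* (x :* X)) :* d₃ :- x :^ 2 :* e₃))
           refl x (x ^ n) ν (c 0 n) d₁ d₂ d₃ (c 2 1) (c 3 2) ⟩
      - ((ι (+ 1) + ν) ^ 2 * x ^ (1 ℕ.+ n) * d₁)
        - ((ι (+ 2) * (ι (+ 1) + ν) + ι (+ 1)) * x ^ (2 ℕ.+ n) * d₂ - x * c 2 1)
        - ι (+ 2) * (x ^ (3 ℕ.+ n) * d₃ - x ^ 2 * c 3 2)
        ≈⟨ +-congʳ (+-cong (-‿cong (*-congʳ (*-congʳ (^-congˡ 2 (+-homo (+ 1) (+ n))))))
             (-‿cong (+-congʳ (*-congʳ (*-congʳ (+-congʳ (*-congˡ (+-homo (+ 1) (+ n))))))))) ⟨
      - (ι (+ suc n) ^ 2 * x ^ (1 ℕ.+ n) * d₁)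
        - ((ι (+ 2) * ι (+ suc n) + ι (+ 1)) * x ^ (2 ℕ.+ n) * d₂ - x * c 2 1)
        - ι (+ 2) * (x ^ (3 ℕ.+ n) * d₃ - x ^ 2 * c 3 2) ∎
      where
      ν  = ι (+ n)
      d₁ = c 1 (1 ℕ.+ n)
      d₂ = c 2 (2 ℕ.+ n)
      d₃ = c 3 (3 ℕ.+ n)

  -- The sums `P` as iterated differences along `a + b j`.

  module _ {G : ℤ → Carrier} (fib : Fibonacci G) (a b : ℤ) (x : Carrier) where

    private
      G-cong : ∀ {i j} → i ≡ j → G i ≈ G j
      G-cong i≡j = reflexive (≡.cong G i≡j)

      -- `δ` and `binomialSum` copy `Δ` and `P` literally, so at `ι = fromℤ` they are the same by
      -- computation; `y` absorbs the sign `(-1)^(b+1)` into `x`.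
      ε δ y : Carrier
      ε = sgn b
      δ = 1# - ι (L b) * x + ε * x ^ 2
      y = - (ε * x)

    binomialSum : ℕ → ℕ → Carrier
    binomialSum v w =
      ∑[ k ≤ v ] ( ι (+ (v C toℕ k)) * sgn ((b ℤ.+ + 1) ℤ.* + toℕ k) * x ^ toℕ k
                 * G (a ℤ.+ b ℤ.* + w ℤ.- b ℤ.* + toℕ k) )

    -- With E the shift operator of u, differences v is (1 + y E⁻¹)ᵛ u.
    differences : ℕ → ℤ → Carrier
    differences zero    j = G (a ℤ.+ b ℤ.* j)
    differences (suc v) j = differences v j + y * differences v (ℤ.pred j)

    -- `(-1)^((b+1) k)` is the `k`-th power of `(-1)^(b+1) = - ε`, and `y` equals `(- ε) * x`.
    sgn-power : ∀ k → sgn ((b ℤ.+ + 1) ℤ.* + k) * x ^ k ≈ y ^ k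
    sgn-power k = begin
      sgn ((b ℤ.+ + 1) ℤ.* + k) * x ^ k
        ≈⟨ *-congʳ (trans (sgn-* (b ℤ.+ + 1) k) (^-congˡ k (sgn-+1 b))) ⟩
      (- ε) ^ k * x ^ k
        ≈⟨ ^-distrib-* (- ε) x k ⟨
      (- ε * x) ^ k
        ≈⟨ ^-congˡ k (sym (-‿distribˡ-* ε x)) ⟩
      y ^ k ∎
      where open ≈-Reasoning

    -- This is the binomial expansion of `(1 + y E⁻¹)ᵛ` applied to `u`, with `E⁻ᵏ` as the `k`-fold
    -- `pred`.
    binomialSum-terms : ∀ v w → binomialSum v w
      ≈ ∑[ k ≤ v ] (ι (+ (v C toℕ k)) * y ^ toℕ k * differences 0 (fold (+ w) ℤ.pred (toℕ k)))
    binomialSum-terms v w = sum-cong-≋ {suc v} λ k → *-cong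
      (trans (*-assoc _ _ _) (*-congˡ {ι (+ (v C toℕ k))} (sgn-power (toℕ k))))
      (G-cong (progression-index a b (+ w) (toℕ k)))

    -- Only the levels 1, 2 and 3 occur in the final formula, so the binomial theorem is verified at
    -- each by expansion; the binomial coefficients reduce to numerals.
    binomialSum₁ : ∀ w → binomialSum 1 w ≈ differences 1 (+ w)
    binomialSum₁ w = trans (binomialSum-terms 1 w) (trans
      -- `z` is the `0#` that closes the unfolded sum; it stays an atom for the solver, as
      -- `con (+ 0)` would be `ι (+ 0)`.
      (solve 4 (λ y u₀ u₁ z →
          con (+ 1) :* y :^ 0 :* u₀ :+ (con (+ 1) :* y :^ 1 :* u₁ :+ z)
            := (u₀ :+ y :* u₁) :+ z)
        refl y (u 0) (u 1) 0#)
      (+-identityʳ _))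
      where u = λ k → differences 0 (fold (+ w) ℤ.pred k)

    binomialSum₂ : ∀ w → binomialSum 2 w ≈ differences 2 (+ w)
    binomialSum₂ w = trans (binomialSum-terms 2 w) (trans
      (solve 5 (λ y u₀ u₁ u₂ z →
          con (+ 1) :* y :^ 0 :* u₀ :+ (con (+ 2) :* y :^ 1 :* u₁ :+ (con (+ 1) :* y :^ 2 :* u₂ :+ z))
            := ((u₀ :+ y :* u₁) :+ y :* (u₁ :+ y :* u₂)) :+ z)
        refl y (u 0) (u 1) (u 2) 0#)
      (+-identityʳ _))
      where u = λ k → differences 0 (fold (+ w) ℤ.pred k)

    binomialSum₃ : ∀ w → binomialSum 3 w ≈ differences 3 (+ w)
    binomialSum₃ w = trans (binomialSum-terms 3 w) (trans
      (solve 6 (λ y u₀ u₁ u₂ u₃ z →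
          con (+ 1) :* y :^ 0 :* u₀ :+ (con (+ 3) :* y :^ 1 :* u₁ :+ (con (+ 3) :* y :^ 2 :* u₂
            :+ (con (+ 1) :* y :^ 3 :* u₃ :+ z)))
            := (((u₀ :+ y :* u₁) :+ y :* (u₁ :+ y :* u₂))
                 :+ y :* ((u₁ :+ y :* u₂) :+ y :* (u₂ :+ y :* u₃))) :+ z)
        refl y (u 0) (u 1) (u 2) (u 3) 0#)
      (+-identityʳ _))
      where u = λ k → differences 0 (fold (+ w) ℤ.pred k)

    -- (1 + y E⁻¹) (1 - x E) = δ, because E + ε E⁻¹ acts on u as L_b.
    differences-step : ∀ v j →
      differences (suc v) j ≈ δ * differences v j + x * differences (suc v) (ℤ.suc j)
    differences-step zero j = begin
      u j + y * u (ℤ.pred j)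
        -- Adding and subtracting `x * (L_b * u j)` and `x * u (j + 1)` exposes the combination to
        -- which the three-term relation applies.
        ≈⟨ solve 6 (λ e x l u₀ u₊ u₋ →
             u₀ :+ :- (e :* x) :* u₋
               := ((x :^ 0 :- l :* x) :* u₀ :+ x :* (l :* u₀))
                 :- x :* (u₊ :+ e :* u₋) :+ x :* u₊)
             refl ε x (ι (L b)) (u j) (u (ℤ.suc j)) (u (ℤ.pred j)) ⟩
      ((1# - ι (L b) * x) * u j + x * (ι (L b) * u j))
        - x * (u (ℤ.suc j) + ε * u (ℤ.pred j)) + x * u (ℤ.suc j)
        ≈⟨ +-congʳ (+-congˡ (-‿cong (*-congˡ three-term))) ⟩
      ((1# - ι (L b) * x) * u j + x * (ι (L b) * u j))
        - x * (ι (L b) * u j) + x * u (ℤ.suc j)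
        ≈⟨ solve 5 (λ e x l u₀ u₊ →
             ((x :^ 0 :- l :* x) :* u₀ :+ x :* (l :* u₀)) :- x :* (l :* u₀) :+ x :* u₊
               := (x :^ 0 :- l :* x :+ e :* x :^ 2) :* u₀ :+ x :* (u₊ :+ :- (e :* x) :* u₀))
             refl ε x (ι (L b)) (u j) (u (ℤ.suc j)) ⟩
      δ * u j + x * (u (ℤ.suc j) + y * u j)
        ≈⟨ +-congˡ (*-congˡ (+-congˡ (*-congˡ (reflexive (≡.cong u (ℤ.pred-suc j)))))) ⟨
      δ * u j + x * (u (ℤ.suc j) + y * u (ℤ.pred (ℤ.suc j))) ∎
      where
      open ≈-Reasoning
      u = differences 0

      next : ∀ a b j → a ℤ.+ b ℤ.* (+ 1 ℤ.+ j) ≡ a ℤ.+ b ℤ.* j ℤ.+ b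
      next = ℤ.solve-∀
      previous : ∀ a b j → a ℤ.+ b ℤ.* (ℤ.- + 1 ℤ.+ j) ≡ a ℤ.+ b ℤ.* j ℤ.- b
      previous = ℤ.solve-∀

      three-term : u (ℤ.suc j) + ε * u (ℤ.pred j) ≈ ι (L b) * u j
      three-term = trans (+-cong (G-cong (next a b j)) (*-congˡ (G-cong (previous a b j))))
        (Lucas-three-term fib (a ℤ.+ b ℤ.* j) b)
    differences-step (suc v) j = begin
      q j + y * q (ℤ.pred j)
        -- Applying `1 + y E⁻¹` to the relation at level `v` gives the next level, since `E` and
        -- `E⁻¹` commute; the swap of `suc` and `pred` is this commutation.
        ≈⟨ +-cong (differences-step v j) (*-congˡ (differences-step v (ℤ.pred j))) ⟩
      (δ * p j + x * q (ℤ.suc j)) + y * (δ * p (ℤ.pred j) + x * q (ℤ.suc (ℤ.pred j)))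
        ≈⟨ +-congˡ (*-congˡ (+-congˡ (*-congˡ (reflexive (≡.cong q
             (≡.trans (ℤ.suc-pred j) (≡.sym (ℤ.pred-suc j)))))))) ⟩
      (δ * p j + x * q (ℤ.suc j)) + y * (δ * p (ℤ.pred j) + x * q (ℤ.pred (ℤ.suc j)))
        ≈⟨ solve 7 (λ d x y p₀ p₁ q₀ q₁ →
             (d :* p₀ :+ x :* q₀) :+ y :* (d :* p₁ :+ x :* q₁)
               := d :* (p₀ :+ y :* p₁) :+ x :* (q₀ :+ y :* q₁))
             refl δ x y (p j) (p (ℤ.pred j)) (q (ℤ.suc j)) (q (ℤ.pred (ℤ.suc j))) ⟩
      δ * (p j + y * p (ℤ.pred j)) + x * (q (ℤ.suc j) + y * q (ℤ.pred (ℤ.suc j))) ∎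
      where
      open ≈-Reasoning
      p = differences v
      q = differences (suc v)

    -- Division by `δ` and the closed form.

    module _ (D : Carrier) (δD≈1 : δ * D ≈ 1#) where

      private
        c : ℕ → ℕ → Carrier
        c v n = D ^ v * differences v (+ n)

        -- The additional factor `D` at level `v + 1` cancels `δ`, leaving the recurrence that
        -- `squares-sum` requires.
        c-step : ∀ v n → c (suc v) n ≈ c v n + x * c (suc v) (suc n)
        c-step v n = begin
          D * D ^ v * differences (suc v) (+ n)
            ≈⟨ *-congˡ (differences-step v (+ n)) ⟩
          D * D ^ v * (δ * p + x * q)
            ≈⟨ solve 6 (λ D Dᵛ d x p q →
                 D :* Dᵛ :* (d :* p :+ x :* q) := (d :* D) :* (Dᵛ :* p) :+ x :* (D :* Dᵛ :* q))
                 refl D (D ^ v) δ x p q ⟩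
          (δ * D) * (D ^ v * p) + x * (D * D ^ v * q)
            ≈⟨ +-congʳ (trans (*-congʳ δD≈1) (*-identityˡ _)) ⟩
          D ^ v * p + x * (D * D ^ v * q) ∎
          where
          open ≈-Reasoning
          p = differences v (+ n)
          q = differences (suc v) (+ suc n)

      squares-Fibonacci-sum : ∀ n →
        ∑[ k ≤ n ] (x ^ toℕ k * ι (+ toℕ k) ^ 2 * G (a ℤ.+ b ℤ.* + toℕ k))
          ≈ - (D * ι (+ (n ℕ.+ 1)) ^ 2 * x ^ (n ℕ.+ 1) * binomialSum 1 (n ℕ.+ 1))
            - D ^ 2 * ( ι (+ (2 ℕ.* n ℕ.+ 3)) * x ^ (n ℕ.+ 2) * binomialSum 2 (n ℕ.+ 2)
                      - x * binomialSum 2 1 )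
            - ι (+ 2) * D ^ 3 * ( x ^ (n ℕ.+ 3) * binomialSum 3 (n ℕ.+ 3)
                                - x ^ 2 * binomialSum 3 2 )
      squares-Fibonacci-sum n
        -- Turning the sums into `1 + n`, `2 + n` and `3 + n` lets the powers of `x` unfold.
        rewrite ℕ.+-comm n 1 | ℕ.+-comm n 2 | ℕ.+-comm n 3 = begin
        ∑[ k ≤ n ] (x ^ toℕ k * ι (+ toℕ k) ^ 2 * u (toℕ k))
          ≈⟨ sum-cong-≋ {suc n} (λ k →
               *-congˡ {x ^ toℕ k * ι (+ toℕ k) ^ 2} (sym (*-identityˡ (u (toℕ k))))) ⟩
        ∑[ k ≤ n ] (x ^ toℕ k * ι (+ toℕ k) ^ 2 * c 0 (toℕ k))
          -- The inclusive bound `n` means `suc n` terms, so the coefficient `2 n + 1` becomes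
          -- `2 (n + 1) + 1 = 2 n + 3`.
          ≈⟨ squares-sum c x c-step (suc n) ⟩
        - (ν ^ 2 * x ^ (1 ℕ.+ n) * c 1 (1 ℕ.+ n))
          - ((ι (+ 2) * ν + ι (+ 1)) * x ^ (2 ℕ.+ n) * c 2 (2 ℕ.+ n) - x * c 2 1)
          - ι (+ 2) * (x ^ (3 ℕ.+ n) * c 3 (3 ℕ.+ n) - x ^ 2 * c 3 2)
          ≈⟨ +-congʳ (+-congˡ (-‿cong (+-congʳ (*-congʳ (*-congʳ coefficient))))) ⟩
        - (ν ^ 2 * x ^ (1 ℕ.+ n) * c 1 (1 ℕ.+ n))
          - (μ * x ^ (2 ℕ.+ n) * c 2 (2 ℕ.+ n) - x * c 2 1)
          - ι (+ 2) * (x ^ (3 ℕ.+ n) * c 3 (3 ℕ.+ n) - x ^ 2 * c 3 2)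
          ≈⟨ solve 10 (λ D x X ν μ p₁ p₂ p₃ q₂ q₃ →
               :- (ν :^ 2 :* X :* (D :^ 1 :* p₁))
                 :- (μ :* (x :* X) :* (D :^ 2 :* p₂) :- x :* (D :^ 2 :* q₂))
                 :- con (+ 2) :* (x :* (x :* X) :* (D :^ 3 :* p₃) :- x :^ 2 :* (D :^ 3 :* q₃))
               := :- (D :* ν :^ 2 :* X :* p₁)
                 :- D :^ 2 :* (μ :* (x :* X) :* p₂ :- x :* q₂)
                 :- con (+ 2) :* D :^ 3 :* (x :* (x :* X) :* p₃ :- x :^ 2 :* q₃))
             refl D x (x ^ (1 ℕ.+ n)) ν μ
               (differences 1 (+ (1 ℕ.+ n))) (differences 2 (+ (2 ℕ.+ n))) (differences 3 (+ (3 ℕ.+ n)))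
               (differences 2 (+ 1)) (differences 3 (+ 2)) ⟩
        - (D * ν ^ 2 * x ^ (1 ℕ.+ n) * differences 1 (+ (1 ℕ.+ n)))
          - D ^ 2 * (μ * x ^ (2 ℕ.+ n) * differences 2 (+ (2 ℕ.+ n)) - x * differences 2 (+ 1))
          - ι (+ 2) * D ^ 3 * (x ^ (3 ℕ.+ n) * differences 3 (+ (3 ℕ.+ n)) - x ^ 2 * differences 3 (+ 2))
          ≈⟨ +-cong
               (+-cong (-‿cong (*-congˡ (binomialSum₁ (1 ℕ.+ n))))
                 (-‿cong (*-congˡ (+-cong (*-congˡ (binomialSum₂ (2 ℕ.+ n)))
                                          (-‿cong (*-congˡ (binomialSum₂ 1)))))))
               (-‿cong (*-congˡ (+-cong (*-congˡ (binomialSum₃ (3 ℕ.+ n)))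
                                        (-‿cong (*-congˡ (binomialSum₃ 2)))))) ⟨
        - (D * ν ^ 2 * x ^ (1 ℕ.+ n) * binomialSum 1 (1 ℕ.+ n))
          - D ^ 2 * (μ * x ^ (2 ℕ.+ n) * binomialSum 2 (2 ℕ.+ n) - x * binomialSum 2 1)
          - ι (+ 2) * D ^ 3 * (x ^ (3 ℕ.+ n) * binomialSum 3 (3 ℕ.+ n) - x ^ 2 * binomialSum 3 2) ∎
        where
        open ≈-Reasoning
        u : ℕ → Carrier
        u k = G (a ℤ.+ b ℤ.* + k)
        ν = ι (+ suc n)
        μ = ι (+ (2 ℕ.* n ℕ.+ 3))

        coefficient : ι (+ 2) * ν + ι (+ 1) ≈ μ
        coefficient = trans (+-congʳ (sym (*-homo (+ 2) (+ suc n))))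
          (trans (sym (+-homo (+ 2 ℤ.* + suc n) (+ 1)))
            (reflexive (≡.cong ι (≡.trans (≡.cong (ℤ._+ + 1) (≡.sym (ℤ.pos-* 2 (suc n))))
              (≡.cong +_ (2[1+n]+1 n))))))
          where
          2[1+n]+1 : ∀ n → 2 ℕ.* (1 ℕ.+ n) ℕ.+ 1 ≡ 2 ℕ.* n ℕ.+ 3
          2[1+n]+1 = ℕ.solve-∀

-- The embeddings of ℤ in ℚ and ℂ.

/1-homo-+ : ∀ i j → (i ℤ.+ j) ℚ./ 1 ≡ (i ℚ./ 1) ℚ.+ (j ℚ./ 1)
-- `i / 1` is brought to lowest terms by a gcd and does not compute for a variable `i`; in the
-- unnormalised rationals the claim is a cross-multiplied identity of integers.
/1-homo-+ i j = ℚ.toℚᵘ-injective (ℚᵘ.≃-trans (ℚ.toℚᵘ-fromℚᵘ (ℚᵘ.mkℚᵘ (i ℤ.+ j) 0))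
  (ℚᵘ.≃-trans (ℚᵘ.*≡* (identity i j))
  (ℚᵘ.≃-sym (ℚᵘ.≃-trans (ℚ.toℚᵘ-homo-+ (i ℚ./ 1) (j ℚ./ 1))
    (ℚᵘ.+-cong (ℚ.toℚᵘ-fromℚᵘ (ℚᵘ.mkℚᵘ i 0)) (ℚ.toℚᵘ-fromℚᵘ (ℚᵘ.mkℚᵘ j 0)))))))
  where
  identity : ∀ i j → (i ℤ.+ j) ℤ.* + 1 ≡ (i ℤ.* + 1 ℤ.+ j ℤ.* + 1) ℤ.* + 1
  identity = ℤ.solve-∀

/1-homo-* : ∀ i j → (i ℤ.* j) ℚ./ 1 ≡ (i ℚ./ 1) ℚ.* (j ℚ./ 1)
/1-homo-* i j = ℚ.toℚᵘ-injective (ℚᵘ.≃-trans (ℚ.toℚᵘ-fromℚᵘ (ℚᵘ.mkℚᵘ (i ℤ.* j) 0))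
  (ℚᵘ.≃-sym (ℚᵘ.≃-trans (ℚ.toℚᵘ-homo-* (i ℚ./ 1) (j ℚ./ 1))
    (ℚᵘ.*-cong (ℚ.toℚᵘ-fromℚᵘ (ℚᵘ.mkℚᵘ i 0)) (ℚ.toℚᵘ-fromℚᵘ (ℚᵘ.mkℚᵘ j 0))))))

/1-homo-neg : ∀ i → (ℤ.- i) ℚ./ 1 ≡ ℚ.- (i ℚ./ 1)
/1-homo-neg i = ℚ.toℚᵘ-injective (ℚᵘ.≃-trans (ℚ.toℚᵘ-fromℚᵘ (ℚᵘ.mkℚᵘ (ℤ.- i) 0))
  (ℚᵘ.≃-sym (ℚᵘ.≃-trans (ℚ.toℚᵘ-homo‿- (i ℚ./ 1))
    (ℚᵘ.-‿cong (ℚ.toℚᵘ-fromℚᵘ (ℚᵘ.mkℚᵘ i 0))))))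

open import Defs hiding (L)

-- Integers are constant sequences with imaginary part `0`, so the laws reduce to termwise ones in
-- ℚ.
fromℤ-homomorphism : ℤ.+-*-rawRing -Raw-AlmostCommutative⟶ fromCommutativeRing commutativeRing
fromℤ-homomorphism = record
  { ⟦_⟧    = fromℤ
  ; +-homo = λ i j → Real.pointwise (λ _ → /1-homo-+ i j) , Real.pointwise (λ _ → ≡.refl)
  ; *-homo = λ i j →
        Real.pointwise (λ _ → ≡.trans (/1-homo-* i j)
          (solve 2 (λ p q → p :* q := p :* q :- con ℚ.0ℚ :* con ℚ.0ℚ) ≡.refl (i ℚ./ 1) (j ℚ./ 1)))
      , Real.pointwise (λ _ →
          solve 2 (λ p q → con ℚ.0ℚ := p :* con ℚ.0ℚ :+ con ℚ.0ℚ :* q) ≡.refl (i ℚ./ 1) (j ℚ./ 1))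
  ; -‿homo = λ i → Real.pointwise (λ _ → /1-homo-neg i) , Real.pointwise (λ _ → ≡.refl)
  ; 0-homo = CommutativeRing.refl commutativeRing
  ; 1-homo = CommutativeRing.refl commutativeRing
  }
  where
  open Complex using (_,_)
  open +-*-Solver using (solve; _:=_; _:+_; _:*_; _:-_; con)

open IntegerAlgebra commutativeRing fromℤ-homomorphism using (squares-Fibonacci-sum)

mainTheorem3 : (G : ℤ → ℂ) → IsGeneralizedFibonacci G →
    (a b : ℤ) (n : ℕ) (x : ℂ) (Δ#0 : Δ b x # 0#) →
    let Δ⁻¹ = inv (Δ b x) Δ#0 in
    ∑[ k ≤ n ] (x ^ toℕ k * fromℕ (toℕ k) ^ 2 * G (a ℤ.+ b ℤ.* + toℕ k))
    ≈ - (Δ⁻¹ * fromℕ (n ℕ.+ 1) ^ 2 * x ^ (n ℕ.+ 1) * P G a b x 1 (n ℕ.+ 1))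
    - Δ⁻¹ ^ 2 * ( fromℕ (2 ℕ.* n ℕ.+ 3) * x ^ (n ℕ.+ 2) * P G a b x 2 (n ℕ.+ 2)
    - x * P G a b x 2 1 )
    - fromℕ 2 * Δ⁻¹ ^ 3 * ( x ^ (n ℕ.+ 3) * P G a b x 3 (n ℕ.+ 3)
    - x ^ 2 * P G a b x 3 2 )
mainTheorem3 G fib a b n x Δ#0 =
  -- Apartness of `Δ` from zero yields the inverse `D`; the two statements then agree by
  -- computation.
  squares-Fibonacci-sum {G} fib a b x (inv (Δ b x) Δ#0) (inv-inverse (Δ b x) Δ#0) n
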